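{- For all integers $n \geq 0$ we have \[ |A_{2n + 1}(2143)| = \frac{2\, (3n + 3)!}{n!\,(n + 1)!\,(n + 2)!\, (2n + 1)(2n + 2)(2n + 3)}. \]
   Context: A permutation $w = w_1w_2\cdots w_m$ of length $m$ is a word containing each element of $[m]=\{1,\dots,m\}$ exactly once. It is alternating if $w_1 < w_2 > w_3 < w_4 > \cdots$ (up-down convention); $A_m$ is the set of alternating permutations of length $m$. A permutation $w$ contains the pattern $p = p_1 \cdots p_k \in S_k$ if there are indices $i_1 < \cdots < i_k$ such that $w_{i_\ell} < w_{i_r}$ if and only if $p_\ell < p_r$; otherwise $w$ avoids $p$. $A_m(p)$ is the set of elements of $A_m$ that avoid $p$, and $|S|$ denotes the size of the set $S$. -}

module Defs where

open import Data.Fin.Base using (Fin; toℕ; _<_)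
open import Data.Fin.Patterns using (0F; 1F; 2F; 3F)
open import Data.Fin.Permutation using (Permutation′; permutation; _⟨$⟩ʳ_; _≈_)
open import Data.Nat.Base using (ℕ; suc; NonZero; _+_; _*_; _!)
open import Data.Nat.Divisibility using (_∣_; _∤_)
open import Data.Nat.Properties using (m*n≢0; _!≢0; +-comm)
open import Data.Product.Base using (Σ; Σ-syntax; _×_; proj₁)
open import Function.Bundles using (Bijection; _⇔_)
open import Level using (0ℓ)
open import Relation.Binary.Bundles using (Setoid)
open import Relation.Binary.PropositionalEquality
  using (_≡_; refl; sym; trans; subst; setoid)
open import Relation.Nullary.Negation using (¬_)
open import Relation.Unary using (Pred; _∩_)

-- A permutation w of length m is read as the word w₁ ⋯ wₘ of its values.
-- Positions and values both start at 0, so wᵢ₊₁ is 1 + toℕ (w ⟨$⟩ʳ i) for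
-- the position i.

-- Position i is the (toℕ i + 1)-st letter, so the ascents w₁ < w₂, w₃ < w₄, …
-- start at the positions with even index.
Alternating : ∀ {m} → Pred (Permutation′ m) 0ℓ
Alternating w = ∀ i j → toℕ j ≡ suc (toℕ i) →
  (2 ∣ toℕ i → w ⟨$⟩ʳ i < w ⟨$⟩ʳ j) ×
  (2 ∤ toℕ i → w ⟨$⟩ʳ j < w ⟨$⟩ʳ i)

_Contains_ : ∀ {m k} → Permutation′ m → Permutation′ k → Set
_Contains_ {m} {k} w p = Σ[ ι ∈ (Fin k → Fin m) ]
  (∀ {l r} → l < r → ι l < ι r) ×
  (∀ l r → (w ⟨$⟩ʳ ι l < w ⟨$⟩ʳ ι r) ⇔ (p ⟨$⟩ʳ l < p ⟨$⟩ʳ r))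

_Avoids_ : ∀ {m k} → Permutation′ m → Permutation′ k → Set
w Avoids p = ¬ (w Contains p)

A : ∀ m {k} → Permutation′ k → Pred (Permutation′ m) 0ℓ
A m p = Alternating ∩ (_Avoids p)

p2143 : Permutation′ 4
p2143 = permutation word word involutive involutive
  where
  word : Fin 4 → Fin 4
  word 0F = 1F
  word 1F = 0F
  word 2F = 3F
  word 3F = 2F

  involutive : ∀ i → word (word i) ≡ i
  involutive 0F = refl
  involutive 1F = refl
  involutive 2F = refl
  involutive 3F = refl

-- Elements of S are compared as words: pointwise, and irrespective of the
-- proof of membership.
subsetSetoid : ∀ {m} → Pred (Permutation′ m) 0ℓ → Setoid 0ℓ 0ℓ
subsetSetoid {m} S = record
  { Carrier       = Σ (Permutation′ m) S
  ; _≈_           = λ v w → proj₁ v ≈ proj₁ w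
  ; isEquivalence = record
    { refl  = λ _ → refl
    ; sym   = λ eq i → sym (eq i)
    ; trans = λ eq₁ eq₂ i → trans (eq₁ i) (eq₂ i)
    }
  }

∣_∣≡_ : ∀ {m} → Pred (Permutation′ m) 0ℓ → ℕ → Set
∣ S ∣≡ k = Bijection (setoid (Fin k)) (subsetSetoid S)

denominator-nonZero : ∀ n →
  NonZero (n ! * (n + 1) ! * (n + 2) ! * ((2 * n + 1) * (2 * n + 2) * (2 * n + 3)))
denominator-nonZero n =
  (n !≢0 *≢0 (n + 1) !≢0 *≢0 (n + 2) !≢0) *≢0 (+≢0 0 *≢0 +≢0 1 *≢0 +≢0 2)
  where
  infixl 3 _*≢0_
  _*≢0_ : ∀ {a b} → NonZero a → NonZero b → NonZero (a * b)
  _*≢0_ {a} {b} a≢0 b≢0 = m*n≢0 a b ⦃ a≢0 ⦄ ⦃ b≢0 ⦄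

  +≢0 : ∀ c → NonZero (2 * n + suc c)
  +≢0 c = subst NonZero (+-comm (suc c) (2 * n)) _

{-# OPTIONS --safe #-}

-- Call a value free for w if prepending it to w creates no 2143. Deleting the
-- first two letters of an alternating 2143-avoiding permutation leaves another
-- one, and the ways to undo this depend on two labels only: low, the number of
-- free values not above the first letter, and high, the number of letters not
-- below the second letter. The children of a permutation with labels (low , high)
-- have every pair of labels (k , Y) with 1 ≤ k, 1 ≤ Y ≤ high + 1 and
-- k + Y ≤ low + high + 2 exactly once. Appending a column to a standard shifted
-- tableau with rows n + 2, n + 1, n obeys the same rule, so the two families are
-- equinumerous; the tableaux with rows p, q, r number
-- (p + q + r)! / (p! q! r!) · (p - q)(p - r)(q - r) / ((p + q)(p + r)(q + r)).

module Submission where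

open import Defs
open import Data.Empty using (⊥; ⊥-elim)
open import Data.Fin.Base as F using (Fin; zero; suc; toℕ; fromℕ<; punchIn; splitAt; _↑ˡ_; _↑ʳ_)
open import Data.Fin.Patterns using (0F; 1F; 2F; 3F)
open import Data.Fin.Permutation as Perm
  using (Permutation′; _⟨$⟩ʳ_; _⟨$⟩ˡ_; _≈_; insert; remove)
import Data.Fin.Properties as Fₚ
import Data.Integer.Base as ℤ
import Data.Integer.Properties as ℤₚ
open import Data.Nat.Base hiding (_/_)
open import Data.Nat.Divisibility using (_∣_; _∤_; _∣0; ∣1⇒≡1; ∣m+n∣m⇒∣n; ∣m∣n⇒∣m+n; ∣-refl)
open import Data.Nat.Properties
open import Data.Nat.Tactic.RingSolver using (solve-∀)
open import Data.Product.Base using (Σ; ∃; ∃-syntax; _×_; _,_; proj₁; proj₂; map)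
open import Data.Rational.Base using (_/_)
open import Data.Rational.Properties using (fromℚᵘ-cong)
open import Data.Rational.Unnormalised.Base using (mkℚᵘ; *≡*)
open import Data.Sum.Base using (_⊎_; inj₁; inj₂; [_,_]′)
open import Function.Base using (_∘_; case_of_)
open import Function.Bundles using (_⇔_; mk⇔; Equivalence; Bijection)
open import Level using (0ℓ)
open import Relation.Binary.Definitions using (tri<; tri≈; tri>)
open import Relation.Binary.PropositionalEquality
open import Relation.Nullary using (¬_; Dec; yes; no; contradiction)
open import Relation.Nullary.Decidable using (_×-dec_; ¬?)
open import Relation.Unary using (Pred)
open Equivalence using (to; from)

-- Shifted tableaux with three rows

-- shifted x y r counts the standard shifted tableaux whose rows have lengths
-- p = r + y + x, q = r + y and r; it is 0 unless (p , q , r) is strict, that is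
-- unless equal neighbouring rows are empty.
shifted : ℕ → ℕ → ℕ → ℕ
shifted x       zero    zero    = 1
shifted zero    zero    (suc r) = 0
shifted zero    (suc y) r       = 0
shifted (suc x) zero    (suc r) = 0
shifted (suc x) (suc y) zero    = shifted x (suc y) zero + shifted (2 + x) y zero
shifted (suc x) (suc y) (suc r) =
  shifted x (suc y) (suc r) + shifted (2 + x) y (suc r) + shifted (suc x) (2 + y) r

-- Among these, the tableaux whose k largest entries avoid the first row.
shiftedTail : ℕ → ℕ → ℕ → ℕ → ℕ
shiftedTail zero    x y       r       = shifted x y r
shiftedTail (suc k) x zero    r       = 0
shiftedTail (suc k) x (suc y) zero    = shiftedTail k (suc x) y zero
shiftedTail (suc k) x (suc y) (suc r) = shiftedTail k (suc x) y (suc r) + shiftedTail k x (2 + y) r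

-- The (k + 1)-st largest entry either avoids the first row too or can be deleted
-- from its end.
shiftedTail-split : ∀ k x y r →
  shiftedTail k (suc x) y r ≡ shiftedTail (suc k) (suc x) y r + shiftedTail k x y r
shiftedTail-split zero x zero zero = refl
shiftedTail-split zero zero zero (suc r) = refl
shiftedTail-split zero (suc x) zero (suc r) = refl
shiftedTail-split zero x (suc y) zero = +-comm (shifted x (suc y) 0) _
shiftedTail-split zero x (suc y) (suc r) =
  trans (+-assoc (shifted x (suc y) (suc r)) _ _) (+-comm (shifted x (suc y) (suc r)) _)
shiftedTail-split (suc k) x zero r = refl
shiftedTail-split (suc k) x (suc y) zero = shiftedTail-split k (suc x) y zero
shiftedTail-split (suc k) x (suc y) (suc r)
  rewrite shiftedTail-split k (suc x) y (suc r) | shiftedTail-split k x (2 + y) r =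
  swap (shiftedTail (suc k) (2 + x) y (suc r)) (shiftedTail k (suc x) y (suc r))
       (shiftedTail (suc k) (suc x) (2 + y) r) (shiftedTail k x (2 + y) r)
  where
  swap : ∀ a b c d → (a + b) + (c + d) ≡ (a + c) + (b + d)
  swap = solve-∀

-- Only `q + r = y + 2 * r` entries lie outside the first row.
shiftedTail-vanishes : ∀ k x y r → y + 2 * r < k → shiftedTail k x y r ≡ 0
shiftedTail-vanishes (suc k) x zero r _ = refl
shiftedTail-vanishes (suc k) x (suc y) zero (s≤s y<k) = shiftedTail-vanishes k (suc x) y 0 y<k
shiftedTail-vanishes (suc k) x (suc y) (suc r) (s≤s y<k) =
  cong₂ _+_ (shiftedTail-vanishes k (suc x) y (suc r) y<k)
            (shiftedTail-vanishes k x (2 + y) r (subst (_≤ k) (eq y r) y<k))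
  where
  eq : ∀ y r → 1 + (y + 2 * suc r) ≡ 3 + y + 2 * r
  eq = solve-∀

-- The hook-length formula for two and three rows

-- The recursion for shifted, divided by the hook-length formula and with
-- denominators cleared; u, v, w stand for the decremented sums of two rows.
two-row-identity : ∀ x y →
  let q = suc y
      p = suc (x + q)
  in
  p * x + q * (2 + x) ≡ suc x * (x + q + q)
two-row-identity = solve-∀

three-row-identity : ∀ x y r →
  let R = suc r
      Q = suc (y + R)
      P = suc (x + Q)
      u = x + Q + Q
      v = x + Q + R
      w = y + R + R
  in
  P * (suc u * suc v * w * (x * suc y * (x + suc y)))
    + Q * (suc u * v * suc w * ((2 + x) * y * (2 + x + y)))
    + R * (u * suc v * suc w * (suc x * (2 + y) * (suc x + (2 + y))))
  ≡ (P + Q + R) * (suc x * suc y * (suc x + suc y)) * (u * v * w)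
three-row-identity = solve-∀

-- Factorials and row lengths are variables, `(suc q) !` entering as `Q * K`, so that the ring
-- solver meets polynomials only. The hypotheses carry the factor `u` in place of `suc u`;
-- multiplying through by `u` lets both be substituted before it is cancelled.
two-row-step : ∀ a b F K M P Q u X x y .{{_ : NonZero u}} →
  a * (F * (Q * K) * u) ≡ M * x → b * (P * F * K * u) ≡ M * y → P * x + Q * y ≡ X * u →
  (a + b) * (P * F * (Q * K) * suc u) ≡ suc u * M * X
two-row-step a b F K M P Q u X x y eqa eqb poly = *-cancelʳ-≡ _ _ u (begin
  (a + b) * (P * F * (Q * K) * suc u) * u
    ≡⟨ expand a b F K P Q u ⟩
  suc u * (P * (a * (F * (Q * K) * u)) + Q * (b * (P * F * K * u)))
    ≡⟨ cong₂ (λ s t → suc u * (P * s + Q * t)) eqa eqb ⟩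
  suc u * (P * (M * x) + Q * (M * y))
    ≡⟨ factor M P Q u x y ⟩
  suc u * M * (P * x + Q * y)
    ≡⟨ cong (suc u * M *_) poly ⟩
  suc u * M * (X * u)
    ≡⟨ *-assoc (suc u * M) X u ⟨
  suc u * M * X * u ∎)
  where
  open ≡-Reasoning
  expand : ∀ a b F K P Q u → (a + b) * (P * F * (Q * K) * suc u) * u ≡
           suc u * (P * (a * (F * (Q * K) * u)) + Q * (b * (P * F * K * u)))
  expand = solve-∀
  factor : ∀ M P Q u x y →
           suc u * (P * (M * x) + Q * (M * y)) ≡ suc u * M * (P * x + Q * y)
  factor = solve-∀

-- Induction on deleting the largest entry. The row lengths are tied to `x` and `y` by equations
-- because the shapes after a deletion match only up to `+-suc`.
shifted-hook₂ : ∀ x y {p q u} → q ≡ y → p ≡ x + q → u ≡ p + q →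
  shifted x y 0 * (p ! * q ! * u) ≡ u ! * x
shifted-hook₂ x zero {p} refl refl refl rewrite +-identityʳ x | +-identityʳ x =
  trans (+-identityʳ _) (cong (_* x) (*-identityʳ (x !)))
shifted-hook₂ zero (suc y) {u = u} refl refl refl = sym (*-zeroʳ (u !))
shifted-hook₂ (suc x) (suc y) {suc p} {suc q} {suc u} refl refl refl =
  two-row-step (shifted x (suc y) 0) (shifted (2 + x) y 0) (p !) (q !) (u !) (suc p) (suc q) u (suc x) x (2 + x)
    (shifted-hook₂ x (suc y) refl refl refl)
    (shifted-hook₂ (2 + x) y refl (cong suc (+-suc x y)) (+-suc (x + suc y) y))
    (two-row-identity x y)
  where instance
  u≢0 : NonZero u
  u≢0 = subst NonZero (sym (+-suc (x + suc y) y)) _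

-- Deleting from a row lowers the two pairwise sums that involve it, so each hypothesis keeps just
-- one of `suc u`, `suc v`, `suc w`.
three-row-step : ∀ a b c F K L M P Q R u v w X x y z n
  .{{_ : NonZero u}} .{{_ : NonZero v}} .{{_ : NonZero w}} →
  a * (F * (Q * K * (R * L)) * (u * v * suc w)) ≡ M * x →
  b * (P * F * (K * (R * L)) * (u * suc v * w)) ≡ M * y →
  c * (P * F * (Q * K * L) * (suc u * v * w)) ≡ M * z →
  P * (suc u * suc v * w * x) + Q * (suc u * v * suc w * y) + R * (u * suc v * suc w * z)
    ≡ n * X * (u * v * w) →
  (a + b + c) * (P * F * (Q * K * (R * L)) * (suc u * suc v * suc w)) ≡ n * M * X
three-row-step a b c F K L M P Q R u v w X x y z n eqa eqb eqc poly =
  *-cancelʳ-≡ _ _ (u * v * w) {{m*n≢0 (u * v) w {{m*n≢0 u v}}}} (begin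
  (a + b + c) * (P * F * (Q * K * (R * L)) * (suc u * suc v * suc w)) * (u * v * w)
    ≡⟨ expand a b c F K L P Q R u v w ⟩
  P * (suc u * suc v * w * (a * (F * (Q * K * (R * L)) * (u * v * suc w)))) +
  Q * (suc u * v * suc w * (b * (P * F * (K * (R * L)) * (u * suc v * w)))) +
  R * (u * suc v * suc w * (c * (P * F * (Q * K * L) * (suc u * v * w))))
    ≡⟨ cong₂ _+_ (cong₂ (λ s t → P * (suc u * suc v * w * s) + Q * (suc u * v * suc w * t)) eqa eqb)
                 (cong (λ s → R * (u * suc v * suc w * s)) eqc) ⟩
  P * (suc u * suc v * w * (M * x)) + Q * (suc u * v * suc w * (M * y)) + R * (u * suc v * suc w * (M * z))
    ≡⟨ factor M P Q R u v w x y z ⟩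
  M * (P * (suc u * suc v * w * x) + Q * (suc u * v * suc w * y) + R * (u * suc v * suc w * z))
    ≡⟨ cong (M *_) poly ⟩
  M * (n * X * (u * v * w))
    ≡⟨ regroup M n X (u * v * w) ⟩
  n * M * X * (u * v * w) ∎)
  where
  open ≡-Reasoning
  expand : ∀ a b c F K L P Q R u v w →
    (a + b + c) * (P * F * (Q * K * (R * L)) * (suc u * suc v * suc w)) * (u * v * w) ≡
    P * (suc u * suc v * w * (a * (F * (Q * K * (R * L)) * (u * v * suc w)))) +
    Q * (suc u * v * suc w * (b * (P * F * (K * (R * L)) * (u * suc v * w)))) +
    R * (u * suc v * suc w * (c * (P * F * (Q * K * L) * (suc u * v * w))))
  expand = solve-∀
  factor : ∀ M P Q R u v w x y z →
    P * (suc u * suc v * w * (M * x)) + Q * (suc u * v * suc w * (M * y)) + R * (u * suc v * suc w * (M * z)) ≡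
    M * (P * (suc u * suc v * w * x) + Q * (suc u * v * suc w * y) + R * (u * suc v * suc w * z))
  factor = solve-∀
  regroup : ∀ M n X u → M * (n * X * u) ≡ n * M * X * u
  regroup = solve-∀

shifted-hook₃ : ∀ x y r {p q u v w n} → q ≡ y + r → p ≡ x + q →
  u ≡ p + q → v ≡ p + r → w ≡ q + r → n ≡ p + q + r →
  shifted x y r * (p ! * (q ! * r !) * (u * v * w)) ≡ n ! * (x * y * (x + y))
-- `w` and `y` are both 0, so the cleared formula degenerates to 0 on both sides.
shifted-hook₃ x zero zero {p} {u = u} {v} {n = n} refl refl refl refl refl refl = begin
  1 * (p ! * 1 * (u * v * 0))  ≡⟨ zeros (p !) u v ⟩
  0                            ≡⟨ *-zeroʳ (n !) ⟨
  n ! * 0                      ≡⟨ cong (λ z → n ! * (z * (x + 0))) (*-zeroʳ x) ⟨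
  n ! * (x * 0 * (x + 0))      ∎
  where
  open ≡-Reasoning
  zeros : ∀ p u v → 1 * (p * 1 * (u * v * 0)) ≡ 0
  zeros = solve-∀
shifted-hook₃ zero zero (suc r) {n = n} _ _ _ _ _ _ = sym (*-zeroʳ (n !))
shifted-hook₃ zero (suc y) r {n = n} _ _ _ _ _ _ = sym (*-zeroʳ (n !))
shifted-hook₃ (suc x) zero (suc r) {n = n} _ _ _ _ _ _ =
  sym (trans (cong (λ z → n ! * (z * (suc x + 0))) (*-zeroʳ x)) (*-zeroʳ (n !)))
-- An empty third row reduces the claim to two rows: `v` and `w` become the row lengths `p` and `q`,
-- which are also the differences to the empty row on the right.
shifted-hook₃ (suc x) (suc y) zero {p} {q} {n = n} q≡ p≡ u≡ v≡ w≡ n≡ =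
  two-rows (trans q≡ (+-identityʳ _)) p≡ u≡ (trans v≡ (+-identityʳ p)) (trans w≡ (+-identityʳ q))
    (trans (trans n≡ (+-identityʳ (p + q))) (sym u≡))
  where
  two-rows : ∀ {x y p q u v w n} → q ≡ y → p ≡ x + q → u ≡ p + q → v ≡ p → w ≡ q → n ≡ u →
    shifted x y 0 * (p ! * (q ! * 1) * (u * v * w)) ≡ n ! * (x * y * (x + y))
  two-rows {x} {y} {p} {q} {u} refl refl u≡ refl refl refl = begin
    shifted x q 0 * (p ! * (q ! * 1) * (u * p * q))  ≡⟨ pull (shifted x q 0) (p !) (q !) u p q ⟩
    shifted x q 0 * (p ! * q ! * u) * (p * q)        ≡⟨ cong (_* (p * q)) (shifted-hook₂ x q refl refl u≡) ⟩
    u ! * x * (p * q)                                ≡⟨ push (u !) x p q ⟩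
    u ! * (x * q * p)                                ∎
    where
    open ≡-Reasoning
    pull : ∀ a F K u P Q → a * (F * (K * 1) * (u * P * Q)) ≡ a * (F * K * u) * (P * Q)
    pull = solve-∀
    push : ∀ M X P Q → M * X * (P * Q) ≡ M * (X * Q * P)
    push = solve-∀
shifted-hook₃ (suc x) (suc y) (suc r) {suc p} {suc q} {suc u} {suc v} {suc w} {suc n}
  refl refl refl refl refl refl =
  three-row-step (shifted x (suc y) (suc r)) (shifted (2 + x) y (suc r)) (shifted (suc x) (2 + y) r)
    (p !) (q !) (r !) (n !) (suc p) (suc q) (suc r) u v w
    (suc x * suc y * (suc x + suc y))
    (x * suc y * (x + suc y)) ((2 + x) * y * (2 + x + y)) (suc x * (2 + y) * (suc x + (2 + y)))
    (suc n)
    (shifted-hook₃ x (suc y) (suc r) refl refl refl refl refl refl)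
    (shifted-hook₃ (2 + x) y (suc r) refl (cong suc (+-suc x q)) (+-suc p q) refl refl
      (cong (_+ suc r) (+-suc p q)))
    (shifted-hook₃ (suc x) (2 + y) r (cong suc (+-suc y r)) refl refl (+-suc p r) (+-suc q r)
      (+-suc (p + suc q) r))
    (three-row-identity x y r)
  where instance
  u≢0 : NonZero u
  u≢0 = subst NonZero (sym (+-suc p q)) _
  v≢0 : NonZero v
  v≢0 = subst NonZero (sym (+-suc p r)) _
  w≢0 : NonZero w
  w≢0 = subst NonZero (sym (+-suc q r)) _

shifted-staircase : ∀ n → shifted 1 1 n *
  (n ! * (n + 1) ! * (n + 2) ! * ((2 * n + 1) * (2 * n + 2) * (2 * n + 3))) ≡ 2 * (3 * n + 3) !
shifted-staircase n = begin
  shifted 1 1 n * (n ! * (n + 1) ! * (n + 2) ! * ((2 * n + 1) * (2 * n + 2) * (2 * n + 3)))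
    ≡⟨ cong (shifted 1 1 n *_) (reorder (n !) ((n + 1) !) ((n + 2) !) (2 * n + 1) (2 * n + 2) (2 * n + 3)) ⟩
  shifted 1 1 n * ((n + 2) ! * ((n + 1) ! * n !) * ((2 * n + 3) * (2 * n + 2) * (2 * n + 1)))
    -- The row differences 1, 1 and 2 give the constant 2.
    ≡⟨ shifted-hook₃ 1 1 n (+-comm n 1) (+-suc n 1) (eq₁ n) (eq₂ n) (eq₃ n) (eq₄ n) ⟩
  (3 * n + 3) ! * 2
    ≡⟨ *-comm ((3 * n + 3) !) 2 ⟩
  2 * (3 * n + 3) ! ∎
  where
  open ≡-Reasoning
  reorder : ∀ a b c u v w → a * b * c * (u * v * w) ≡ c * (b * a) * (w * v * u)
  reorder = solve-∀
  eq₁ : ∀ n → 2 * n + 3 ≡ n + 2 + (n + 1)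
  eq₁ = solve-∀
  eq₂ : ∀ n → 2 * n + 2 ≡ n + 2 + n
  eq₂ = solve-∀
  eq₃ : ∀ n → 2 * n + 1 ≡ n + 1 + n
  eq₃ = solve-∀
  eq₄ : ∀ n → 3 * n + 3 ≡ n + 2 + (n + 1) + n
  eq₄ = solve-∀

-- Deleting and prepending letters

punchIn-< : ∀ {n} (v : Fin (suc n)) x → toℕ x < toℕ v → toℕ (punchIn v x) ≡ toℕ x
punchIn-< (suc v) zero    _         = refl
punchIn-< (suc v) (suc x) (s≤s x<v) = cong suc (punchIn-< v x x<v)

punchIn-≥ : ∀ {n} (v : Fin (suc n)) x → toℕ v ≤ toℕ x → toℕ (punchIn v x) ≡ suc (toℕ x)
punchIn-≥ zero    x       _         = refl
punchIn-≥ (suc v) (suc x) (s≤s v≤x) = cong suc (punchIn-≥ v x v≤x)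

-- Inserting `v` raises exactly the values from `v` on, and these are at least `s` before and after.
punchIn-<-⇔ : ∀ {n} (v : Fin (suc n)) x {s} → s ≤ toℕ v → toℕ (punchIn v x) < s ⇔ toℕ x < s
punchIn-<-⇔ v x {s} s≤v with toℕ x <? toℕ v
... | yes x<v rewrite punchIn-< v x x<v = mk⇔ (λ p → p) (λ p → p)
... | no  x≮v rewrite punchIn-≥ v x (≮⇒≥ x≮v) =
  mk⇔ (<-trans (n<1+n _)) (λ x<s → contradiction (<-≤-trans x<s s≤v) x≮v)

punchIn->-⇔ : ∀ {n} (v : Fin (suc n)) x {s} → toℕ v ≤ s → s < toℕ (punchIn v x) ⇔ s ≤ toℕ x
punchIn->-⇔ v x {s} v≤s with toℕ x <? toℕ v
... | yes x<v rewrite punchIn-< v x x<v =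
  mk⇔ <⇒≤ (λ s≤x → contradiction (≤-trans v≤s s≤x) (<⇒≱ x<v))
... | no  x≮v rewrite punchIn-≥ v x (≮⇒≥ x≮v) = mk⇔ ≤-pred s≤s

punchIn-mono-cancel-< : ∀ {n} (v : Fin (suc n)) x y → (punchIn v x F.< punchIn v y) ⇔ x F.< y
punchIn-mono-cancel-< v x y =
  mk⇔ (λ p → ≰⇒> (<⇒≱ p ∘ Fₚ.punchIn-mono-≤ v y x)) (λ p → ≰⇒> (<⇒≱ p ∘ Fₚ.punchIn-cancel-≤ v y x))

¬⇔¬ : ∀ {P Q : Set} → P ⇔ Q → (¬ P) ⇔ (¬ Q)
¬⇔¬ e = mk⇔ (_∘ from e) (_∘ to e)

infix 8 _at_
_at_ : ∀ {m} → Permutation′ m → Fin m → ℕ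
w at i = toℕ (w ⟨$⟩ʳ i)

-- Unfolding remove and insert makes conversion checking prohibitively slow.
abstract
  tail : ∀ {m} → Permutation′ (suc m) → Permutation′ m
  tail = remove 0F

  suc-↦ : ∀ {m} (w : Permutation′ (suc m)) k → w ⟨$⟩ʳ suc k ≡ punchIn (w ⟨$⟩ʳ 0F) (tail w ⟨$⟩ʳ k)
  suc-↦ w = Perm.punchIn-permute w 0F

  prepend : ∀ {m} → Fin (suc m) → Permutation′ m → Permutation′ (suc m)
  prepend = insert 0F

  prepend-0F : ∀ {m} v (t : Permutation′ m) → prepend v t ⟨$⟩ʳ 0F ≡ v
  prepend-0F v t = refl

  tail-prepend : ∀ {m} v (t : Permutation′ m) → tail (prepend v t) ≈ t
  tail-prepend v t = Perm.remove-insert 0F v t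

at-injective : ∀ {m} (w : Permutation′ m) {i j} → w at i ≡ w at j → i ≡ j
at-injective w {i} {j} eq = begin
  i                       ≡⟨ Perm.inverseˡ w ⟨
  w ⟨$⟩ˡ (w ⟨$⟩ʳ i)       ≡⟨ cong (w ⟨$⟩ˡ_) (Fₚ.toℕ-injective eq) ⟩
  w ⟨$⟩ˡ (w ⟨$⟩ʳ j)       ≡⟨ Perm.inverseˡ w ⟩
  j                       ∎
  where open ≡-Reasoning

module _ {m} (w : Permutation′ (suc m)) where
  private t = tail w

  suc-at : ∀ k → w at suc k ≡ toℕ (punchIn (w ⟨$⟩ʳ 0F) (t ⟨$⟩ʳ k))
  suc-at k = cong toℕ (suc-↦ w k)

  tail-< : ∀ k {s} → s ≤ w at 0F → w at suc k < s ⇔ t at k < s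
  tail-< k s≤ rewrite suc-at k = punchIn-<-⇔ (w ⟨$⟩ʳ 0F) _ s≤

  tail-≥ : ∀ k {s} → s ≤ w at 0F → s ≤ w at suc k ⇔ s ≤ t at k
  tail-≥ k s≤ = mk⇔ (λ p → ≮⇒≥ (≤⇒≯ p ∘ from (tail-< k s≤))) (λ p → ≮⇒≥ (≤⇒≯ p ∘ to (tail-< k s≤)))

  tail-> : ∀ k {s} → w at 0F ≤ s → s < w at suc k ⇔ s ≤ t at k
  tail-> k ≤s rewrite suc-at k = punchIn->-⇔ (w ⟨$⟩ʳ 0F) _ ≤s

  tail-order : ∀ j k → w at suc j < w at suc k ⇔ t at j < t at k
  tail-order j k rewrite suc-at j | suc-at k = punchIn-mono-cancel-< (w ⟨$⟩ʳ 0F) _ _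

  suc-at-≥ : ∀ k → w at 0F ≤ t at k → w at suc k ≡ suc (t at k)
  suc-at-≥ k p = trans (suc-at k) (punchIn-≥ (w ⟨$⟩ʳ 0F) _ p)

-- Occurrences of 2143 and free values

-- A new first letter with exactly s smaller letters would start a 2143.
Blocked : ∀ {m} → Permutation′ m → ℕ → Set
Blocked w s = ∃[ i ] ∃[ j ] ∃[ k ]
  i F.< j × j F.< k × w at i < s × s ≤ w at k × w at k < w at j

Free : ∀ {m} → Permutation′ m → ℕ → Set
Free w s = ¬ Blocked w s

blocked? : ∀ {m} (w : Permutation′ m) s → Dec (Blocked w s)
blocked? w s = Fₚ.any? λ i → Fₚ.any? λ j → Fₚ.any? λ k →
  i Fₚ.<? j ×-dec j Fₚ.<? k ×-dec w at i <? s ×-dec s ≤? w at k ×-dec w at k <? w at j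

Occurs2143 : ∀ {m} → Permutation′ m → Set
Occurs2143 w = ∃[ i ] ∃[ j ] ∃[ k ] ∃[ l ]
  i F.< j × j F.< k × k F.< l × w at j < w at i × w at i < w at l × w at l < w at k

contains⇒occurs : ∀ {m} (w : Permutation′ m) → w Contains p2143 → Occurs2143 w
contains⇒occurs w (ι , mono , iff) =
  ι 0F , ι 1F , ι 2F , ι 3F , mono (s≤s z≤n) , mono (s≤s (s≤s z≤n)) , mono (s≤s (s≤s (s≤s z≤n))) ,
  from (iff 1F 0F) (s≤s z≤n) , from (iff 0F 3F) (s≤s (s≤s z≤n)) , from (iff 3F 2F) (s≤s (s≤s (s≤s z≤n)))

occurs⇒contains : ∀ {m} (w : Permutation′ m) → Occurs2143 w → w Contains p2143
occurs⇒contains {m} w (i , j , k , l , i<j , j<k , k<l , wj<wi , wi<wl , wl<wk) =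
  ι , (λ {a} {b} → mono a b) , λ a b → mk⇔ (reflects a b) (preserves a b)
  where
  ι : Fin 4 → Fin m
  ι 0F = i
  ι 1F = j
  ι 2F = k
  ι 3F = l

  mono : ∀ a b → a F.< b → ι a F.< ι b
  mono 0F 1F _ = i<j
  mono 0F 2F _ = <-trans i<j j<k
  mono 0F 3F _ = <-trans i<j (<-trans j<k k<l)
  mono 1F 2F _ = j<k
  mono 1F 3F _ = <-trans j<k k<l
  mono 2F 3F _ = k<l
  mono 1F 1F (s≤s ())
  mono 2F 1F (s≤s ())
  mono 2F 2F (s≤s (s≤s ()))
  mono 3F 1F (s≤s ())
  mono 3F 2F (s≤s (s≤s ()))
  mono 3F 3F (s≤s (s≤s (s≤s ())))

  p : Fin 4 → Fin 4
  p = p2143 ⟨$⟩ʳ_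

  preserves : ∀ a b → p a F.< p b → w at ι a < w at ι b
  preserves 0F 0F (s≤s ())
  preserves 0F 2F _ = <-trans wi<wl wl<wk
  preserves 0F 3F _ = wi<wl
  preserves 1F 0F _ = wj<wi
  preserves 1F 2F _ = <-trans wj<wi (<-trans wi<wl wl<wk)
  preserves 1F 3F _ = <-trans wj<wi wi<wl
  preserves 2F 0F (s≤s ())
  preserves 2F 2F (s≤s (s≤s (s≤s ())))
  preserves 2F 3F (s≤s (s≤s ()))
  preserves 3F 0F (s≤s ())
  preserves 3F 2F _ = wl<wk
  preserves 3F 3F (s≤s (s≤s ()))

  reflects : ∀ a b → w at ι a < w at ι b → p a F.< p b
  reflects a b wa<wb with Fₚ.<-cmp (p a) (p b)
  ... | tri< pa<pb _ _ = pa<pb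
  ... | tri> _ _ pb<pa = contradiction (preserves b a pb<pa) (<-asym wa<wb)
  ... | tri≈ _ pa≡pb _ with refl ← at-injective p2143 {a} {b} (cong toℕ pa≡pb) =
    contradiction wa<wb (<-irrefl refl)

avoids⇔ : ∀ {m} (w : Permutation′ m) → w Avoids p2143 ⇔ (¬ Occurs2143 w)
avoids⇔ w = mk⇔ (_∘ occurs⇒contains w) (_∘ contains⇒occurs w)

-- An occurrence that uses the first letter uses it as the 2, and the other three letters block its
-- value in the tail.
occurs-tail : ∀ {m} (w : Permutation′ (suc m)) →
  Occurs2143 w ⇔ (Occurs2143 (tail w) ⊎ Blocked (tail w) (w at 0F))
occurs-tail w = mk⇔ fwd bwd
  where
  fwd : Occurs2143 w → Occurs2143 (tail w) ⊎ Blocked (tail w) (w at 0F)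
  fwd (0F , suc j , suc k , suc l , _ , s≤s j<k , s≤s k<l , wj<wi , wi<wl , wl<wk) =
    inj₂ (j , k , l , j<k , k<l , to (tail-< w j ≤-refl) wj<wi , to (tail-> w l ≤-refl) wi<wl ,
          to (tail-order w l k) wl<wk)
  fwd (suc i , suc j , suc k , suc l , s≤s i<j , s≤s j<k , s≤s k<l , wj<wi , wi<wl , wl<wk) =
    inj₁ (i , j , k , l , i<j , j<k , k<l , to (tail-order w j i) wj<wi ,
          to (tail-order w i l) wi<wl , to (tail-order w l k) wl<wk)
  bwd : Occurs2143 (tail w) ⊎ Blocked (tail w) (w at 0F) → Occurs2143 w
  bwd (inj₁ (i , j , k , l , i<j , j<k , k<l , wj<wi , wi<wl , wl<wk)) =
    suc i , suc j , suc k , suc l , s≤s i<j , s≤s j<k , s≤s k<l , from (tail-order w j i) wj<wi ,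
    from (tail-order w i l) wi<wl , from (tail-order w l k) wl<wk
  bwd (inj₂ (j , k , l , j<k , k<l , wj<wi , wi<wl , wl<wk)) =
    0F , suc j , suc k , suc l , s≤s z≤n , s≤s j<k , s≤s k<l , from (tail-< w j ≤-refl) wj<wi ,
    from (tail-> w l ≤-refl) wi<wl , from (tail-order w l k) wl<wk

avoids-tail : ∀ {m} (w : Permutation′ (suc m)) →
  w Avoids p2143 ⇔ (tail w Avoids p2143 × Free (tail w) (w at 0F))
avoids-tail w = mk⇔
  (λ av → from (avoids⇔ (tail w)) (to (avoids⇔ w) av ∘ from (occurs-tail w) ∘ inj₁) ,
          to (avoids⇔ w) av ∘ from (occurs-tail w) ∘ inj₂)
  (λ { (av , nb) → from (avoids⇔ w) ([ to (avoids⇔ (tail w)) av , nb ]′ ∘ to (occurs-tail w)) })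

-- The first letter could only serve as the letter below `s`, but it is at least `s`; deleting it
-- changes no comparison of the others with `s`.
blocked-tail : ∀ {m} (w : Permutation′ (suc m)) {s} → s ≤ w at 0F → Blocked w s ⇔ Blocked (tail w) s
blocked-tail w {s} s≤ = mk⇔ fwd bwd
  where
  fwd : Blocked w s → Blocked (tail w) s
  fwd (0F , _ , _ , _ , _ , w0<s , _) = contradiction s≤ (<⇒≱ w0<s)
  fwd (suc i , suc j , suc k , s≤s i<j , s≤s j<k , wi<s , s≤wk , wk<wj) =
    i , j , k , i<j , j<k , to (tail-< w i s≤) wi<s , to (tail-≥ w k s≤) s≤wk , to (tail-order w k j) wk<wj
  bwd : Blocked (tail w) s → Blocked w s
  bwd (i , j , k , i<j , j<k , wi<s , s≤wk , wk<wj) =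
    suc i , suc j , suc k , s≤s i<j , s≤s j<k , from (tail-< w i s≤) wi<s , from (tail-≥ w k s≤) s≤wk ,
    from (tail-order w k j) wk<wj

tail² : ∀ {m} → Permutation′ (2 + m) → Permutation′ m
tail² w = tail (tail w)

tail²-order : ∀ {m} (w : Permutation′ (2 + m)) i j →
  w at suc (suc i) < w at suc (suc j) ⇔ tail² w at i < tail² w at j
tail²-order w i j =
  mk⇔ (to (tail-order (tail w) i j) ∘ to (tail-order w (suc i) (suc j)))
      (from (tail-order w (suc i) (suc j)) ∘ from (tail-order (tail w) i j))

-- Deleting two letters keeps the parity of positions and loses two comparisons. The one between the
-- first two letters becomes weak because `tail w` is standardised without the first letter.
alternating-tail² : ∀ {m} (w : Permutation′ (3 + m)) →
  Alternating w ⇔ (Alternating (tail² w) × w at 0F ≤ tail w at 0F × tail² w at 0F < tail w at 0F)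
alternating-tail² {m} w = mk⇔ fwd bwd
  where
  2+∣ : ∀ {n} → 2 ∣ n ⇔ 2 ∣ 2 + n
  2+∣ = mk⇔ (∣m∣n⇒∣m+n ∣-refl) (λ p → ∣m+n∣m⇒∣n p ∣-refl)
  2∤1 : 2 ∤ 1
  2∤1 p with () ← ∣1⇒≡1 p

  fwd : Alternating w → _
  fwd alt =
    (λ i j eq → map (λ f → to (tail²-order w i j) ∘ f ∘ to 2+∣)
                    (λ f → to (tail²-order w j i) ∘ f ∘ (_∘ from 2+∣))
                    (alt (suc (suc i)) (suc (suc j)) (cong (2 +_) eq))) ,
    to (tail-> w 0F ≤-refl) (proj₁ (alt 0F 1F refl) (2 ∣0)) ,
    to (tail-< (tail w) 0F ≤-refl) (to (tail-order w 1F 0F) (proj₂ (alt 1F 2F refl) 2∤1))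

  bwd : _ → Alternating w
  bwd (alt , w₀≤ , ρ₀<) 0F 1F _ =
    (λ _ → from (tail-> w 0F ≤-refl) w₀≤) , λ 2∤0 → contradiction (2 ∣0) 2∤0
  bwd (alt , w₀≤ , ρ₀<) 1F 2F _ =
    (λ 2∣1 → contradiction 2∣1 2∤1) ,
    λ _ → from (tail-order w 1F 0F) (from (tail-< (tail w) 0F ≤-refl) ρ₀<)
  bwd (alt , _) (suc (suc i)) (suc (suc j)) eq =
    map (λ f → from (tail²-order w i j) ∘ f ∘ from 2+∣)
        (λ f → from (tail²-order w j i) ∘ f ∘ (_∘ to 2+∣))
        (alt i j (suc-injective (suc-injective eq)))

A2143 : ∀ {m} → Pred (Permutation′ m) 0ℓ
A2143 = A _ p2143

-- The first letter is free for `tail w`; being at most `tail w at 0F`, it is free for `tail² w` by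
-- `blocked-tail`.
A-tail² : ∀ {m} (w : Permutation′ (3 + m)) →
  A2143 w ⇔ (A2143 (tail² w) × w at 0F ≤ tail w at 0F × tail² w at 0F < tail w at 0F ×
             Free (tail² w) (tail w at 0F) × Free (tail² w) (w at 0F))
A-tail² w = mk⇔ fwd bwd
  where
  fwd : A2143 w → _
  fwd (alt , av) with to (alternating-tail² w) alt | to (avoids-tail w) av
  ... | alt′ , w₀≤ , ρ₀< | av′ , free₀ with to (avoids-tail (tail w)) av′
  ... | av″ , free₁ = (alt′ , av″) , w₀≤ , ρ₀< , free₁ , free₀ ∘ from (blocked-tail (tail w) w₀≤)

  bwd : _ → A2143 w
  bwd ((alt , av) , w₀≤ , ρ₀< , free₁ , free₀) =
    from (alternating-tail² w) (alt , w₀≤ , ρ₀<) ,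
    from (avoids-tail w) (from (avoids-tail (tail w)) (av , free₁) , free₀ ∘ to (blocked-tail (tail w) w₀≤))

preimage : ∀ {m} (w : Permutation′ m) {s} → s < m → ∃[ k ] w at k ≡ s
preimage w s<m = w ⟨$⟩ˡ fromℕ< s<m , trans (cong toℕ (Perm.inverseʳ w)) (Fₚ.toℕ-fromℕ< s<m)

second-at : ∀ {m} (w : Permutation′ (3 + m)) → A2143 w → w at 1F ≡ suc (tail w at 0F)
second-at w a with to (A-tail² w) a
... | _ , w₀≤ , _ = suc-at-≥ w 0F w₀≤

-- If `s` is below the second letter, the letter one less than the second comes later and completes
-- a blocking triple with the first two. If not, the last two letters of a triple blocking `s`
-- exceed the second letter; together with the first letter of `tail² w` they would block a value
-- that is free there.
free-above : ∀ {m} (w : Permutation′ (3 + m)) → A2143 w →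
  ∀ s → w at 0F < s → Free w s ⇔ w at 1F ≤ s
free-above {m} w a s w₀<s with to (A-tail² w) a
... | _ , w₀≤ , ρ₀< , free₁ , _ = mk⇔ fwd bwd
  where
  u = tail w at 0F
  w₁≡ : w at 1F ≡ suc u
  w₁≡ = second-at w a

  fwd : Free w s → w at 1F ≤ s
  fwd free = ≮⇒≥ λ s<w₁ → free (witness (≤-pred (subst (s <_) w₁≡ s<w₁)))
    where
    witness : s ≤ u → Blocked w s
    witness s≤u with preimage w {u} (m<n⇒m<1+n (Fₚ.toℕ<n (tail w ⟨$⟩ʳ 0F)))
    ... | 0F , eq = contradiction eq (<⇒≢ (<-≤-trans w₀<s s≤u))
    ... | 1F , eq = contradiction (trans (sym w₁≡) eq) 1+n≢n
    ... | suc (suc k) , eq = 0F , 1F , suc (suc k) , s≤s z≤n , s≤s (s≤s z≤n) , w₀<s ,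
      ≤-trans s≤u (≤-reflexive (sym eq)) , ≤-reflexive (trans (cong suc eq) (sym w₁≡))

  bwd : w at 1F ≤ s → Free w s
  bwd w₁≤s (_ , 1F , k , _ , _ , _ , s≤wk , wk<w₁) = <⇒≱ wk<w₁ (≤-trans w₁≤s s≤wk)
  bwd w₁≤s (_ , suc (suc j) , suc 0F , _ , s≤s () , _)
  bwd w₁≤s (_ , suc (suc j) , suc (suc k) , _ , s≤s (s≤s j<k) , _ , s≤wk , wk<wj) =
    free₁ (0F , j , k , 0<j , j<k , ρ₀< , u≤ρk , ρk<ρj)
    where
    ρk<ρj : tail² w at k < tail² w at j
    ρk<ρj = to (tail²-order w k j) wk<wj
    w₁<wk : w at 1F < w at suc (suc k)
    w₁<wk = ≤∧≢⇒< (≤-trans w₁≤s s≤wk) (λ eq → case at-injective w {1F} {suc (suc k)} eq of λ ())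
    u≤ρk : u ≤ tail² w at k
    u≤ρk = to (tail-> (tail w) k ≤-refl) (to (tail-order w 0F (suc k)) w₁<wk)
    0<j : 0 < toℕ j
    0<j = n≢0⇒n>0 λ j≡0 → case Fₚ.toℕ-injective {i = j} {0F} j≡0 of λ
      { refl → <-asym ρ₀< (≤-<-trans u≤ρk ρk<ρj) }

-- Ranks among the values satisfying a predicate

bit : ∀ {P : Set} → Dec P → ℕ
bit (yes _) = 1
bit (no  _) = 0

bit-yes : ∀ {P : Set} (P? : Dec P) → P → bit P? ≡ 1
bit-yes (yes _) _ = refl
bit-yes (no ¬p) p = contradiction p ¬p

bit-no : ∀ {P : Set} (P? : Dec P) → ¬ P → bit P? ≡ 0
bit-no (yes p) ¬p = contradiction p ¬p
bit-no (no  _) _  = refl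

bit-≤1 : ∀ {P : Set} (P? : Dec P) → bit P? ≤ 1
bit-≤1 (yes _) = ≤-refl
bit-≤1 (no  _) = z≤n

bit-cong : ∀ {P Q : Set} (P? : Dec P) (Q? : Dec Q) → P ⇔ Q → bit P? ≡ bit Q?
bit-cong P? (yes q) e = bit-yes P? (from e q)
bit-cong P? (no ¬q) e = bit-no P? (¬q ∘ to e)

module _ {P : ℕ → Set} (P? : ∀ s → Dec (P s)) where

  count≤ : ℕ → ℕ
  count≤ zero    = bit (P? 0)
  count≤ (suc n) = count≤ n + bit (P? (suc n))

  count≤-suc : ∀ {n} → P (suc n) → count≤ (suc n) ≡ suc (count≤ n)
  count≤-suc {n} p = trans (cong (count≤ n +_) (bit-yes (P? (suc n)) p)) (+-comm (count≤ n) 1)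

  count≤-skip : ∀ {n} → ¬ P (suc n) → count≤ (suc n) ≡ count≤ n
  count≤-skip {n} ¬p = trans (cong (count≤ n +_) (bit-no (P? (suc n)) ¬p)) (+-identityʳ _)

  count≤-bound : ∀ n → count≤ n ≤ suc n
  count≤-bound zero    = bit-≤1 (P? 0)
  count≤-bound (suc n) = ≤-trans (+-mono-≤ (count≤-bound n) (bit-≤1 (P? (suc n)))) (≤-reflexive (+-comm (suc n) 1))

  count≤-mono : ∀ {m n} → m ≤ n → count≤ m ≤ count≤ n
  count≤-mono {m} {n} m≤n with m≤n⇒m<n∨m≡n m≤n
  ... | inj₂ refl = ≤-refl
  count≤-mono {m} {suc n} _ | inj₁ m<n = ≤-trans (count≤-mono (≤-pred m<n)) (m≤m+n _ _)

  count≤-strict : ∀ {m n} → m < n → P n → count≤ m < count≤ n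
  count≤-strict {m} {suc n} m<n p rewrite count≤-suc p = s≤s (count≤-mono (≤-pred m<n))

  count≤-injective : ∀ {m n} → P m → P n → count≤ m ≡ count≤ n → m ≡ n
  count≤-injective {m} {n} pm pn eq with <-cmp m n
  ... | tri< m<n _ _ = contradiction eq (<⇒≢ (count≤-strict m<n pn))
  ... | tri≈ _ m≡n _ = m≡n
  ... | tri> _ _ n<m = contradiction (sym eq) (<⇒≢ (count≤-strict n<m pm))

  -- The count starts at 1 or less and grows in steps of at most 1, so every rank up to `count≤ n`
  -- is attained.
  count≤-select : ∀ {i} n → suc i ≤ count≤ n → ∃[ m ] m ≤ n × P m × count≤ m ≡ suc i
  count≤-select zero i< with P? 0 in eq
  ... | yes p = 0 , z≤n , p , trans (cong bit eq) (≤-antisym (s≤s z≤n) i<)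
  count≤-select {i} (suc n) i< with suc i ≤? count≤ n
  ... | yes i≤ = let m , m≤n , r = count≤-select n i≤ in m , m≤n⇒m≤1+n m≤n , r
  ... | no  i≰ with P? (suc n) in eq
  ... | yes p = suc n , ≤-refl , p , ≤-antisym
    (≤-trans (≤-reflexive (count≤-suc p)) (≰⇒> i≰))
    (≤-trans i< (≤-reflexive (cong (λ b → count≤ n + bit b) (sym eq))))
  ... | no ¬p = contradiction (≤-trans i< (≤-reflexive (+-identityʳ _))) i≰

  -- Nothing strictly between `a` and `h` counts, and from `h` on everything does.
  count≤-threshold : ∀ {a h} → a < h → (∀ s → a < s → P s ⇔ h ≤ s) →
    ∀ e → count≤ (h + e) ≡ count≤ a + suc e
  count≤-threshold {a} {suc h} a<h iff zero rewrite +-identityʳ h = begin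
    count≤ (suc h)    ≡⟨ count≤-suc (from (iff (suc h) a<h) ≤-refl) ⟩
    suc (count≤ h)    ≡⟨ cong suc (gap h (≤-pred a<h) ≤-refl) ⟩
    suc (count≤ a)    ≡⟨ +-comm 1 _ ⟩
    count≤ a + 1      ∎
    where
    open ≡-Reasoning
    gap : ∀ n → a ≤ n → n ≤ h → count≤ n ≡ count≤ a
    gap n a≤n n≤h with m≤n⇒m<n∨m≡n a≤n
    ... | inj₂ refl = refl
    gap (suc n) _ n<h | inj₁ a<n =
      trans (count≤-skip (<⇒≱ (s≤s n<h) ∘ to (iff (suc n) a<n))) (gap n (≤-pred a<n) (<⇒≤ n<h))
  count≤-threshold {a} {h} a<h iff (suc e) rewrite +-suc h e = begin
    count≤ (suc (h + e))    ≡⟨ count≤-suc (from (iff _ (<-≤-trans a<h h≤)) h≤) ⟩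
    suc (count≤ (h + e))    ≡⟨ cong suc (count≤-threshold a<h iff e) ⟩
    suc (count≤ a + suc e)  ≡⟨ +-suc _ _ ⟨
    count≤ a + suc (suc e)  ∎
    where
    open ≡-Reasoning
    h≤ : h ≤ suc (h + e)
    h≤ = m≤n⇒m≤1+n (m≤m+n h e)

count≤-cong : ∀ {P Q : ℕ → Set} (P? : ∀ s → Dec (P s)) (Q? : ∀ s → Dec (Q s)) →
  ∀ n → (∀ s → s ≤ n → P s ⇔ Q s) → count≤ P? n ≡ count≤ Q? n
count≤-cong P? Q? zero    e = bit-cong (P? 0) (Q? 0) (e 0 z≤n)
count≤-cong P? Q? (suc n) e =
  cong₂ _+_ (count≤-cong P? Q? n (λ s s≤n → e s (m≤n⇒m≤1+n s≤n)))
            (bit-cong (P? (suc n)) (Q? (suc n)) (e (suc n) ≤-refl))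

abstract
  sites : ∀ {m} → Permutation′ m → ℕ → ℕ
  sites w = count≤ (λ s → ¬? (blocked? w s))

  sites-cong : ∀ {m n} (v : Permutation′ m) (w : Permutation′ n) s →
    (∀ t → t ≤ s → Blocked v t ⇔ Blocked w t) → sites v s ≡ sites w s
  sites-cong v w s e = count≤-cong _ _ s λ t t≤s → ¬⇔¬ (e t t≤s)

  sites-mono : ∀ {m} (w : Permutation′ m) {s t} → s ≤ t → sites w s ≤ sites w t
  sites-mono w = count≤-mono _

  sites-injective : ∀ {m} (w : Permutation′ m) {s t} → Free w s → Free w t → sites w s ≡ sites w t → s ≡ t
  sites-injective w = count≤-injective _

  sites-select : ∀ {m} (w : Permutation′ m) {i} s → suc i ≤ sites w s →
    ∃[ t ] t ≤ s × Free w t × sites w t ≡ suc i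
  sites-select w = count≤-select _

  sites-above : ∀ {m} (w : Permutation′ m) {a h} → a < h → (∀ s → a < s → Free w s ⇔ h ≤ s) →
    ∀ e → sites w (h + e) ≡ sites w a + suc e
  sites-above w = count≤-threshold _

  sites-bound : ∀ {m} (w : Permutation′ m) s → sites w s ≤ suc s
  sites-bound w = count≤-bound _

  -- The value 0 is always free, as no letter lies below it.
  0<sites : ∀ {m} (w : Permutation′ m) s → 0 < sites w s
  0<sites w s = ≤-trans
    (≤-reflexive (sym (bit-yes (¬? (blocked? w 0)) λ { (_ , _ , _ , _ , _ , () , _) })))
    (count≤-mono (λ t → ¬? (blocked? w t)) {0} {s} z≤n)

-- The two labels

-- low counts the free s ≤ w₁. For larger s, being free means s ≥ threshold,
-- so that high + 1 of them are free.
low : ∀ {m} → Permutation′ (suc m) → ℕ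
low w = sites w (w at 0F)

-- Unlike `2 * n`, this lets `suc (double (suc n))` compute to `3 + double n`, so that `tail²`
-- applies without coercions.
double : ℕ → ℕ
double zero    = zero
double (suc n) = 2 + double n

threshold : ∀ n → Permutation′ (suc (double n)) → ℕ
-- A single letter has value 0 and blocks nothing, so all values from 1 on are free and `high` is 0.
threshold zero    w = 1
threshold (suc n) w = w at 1F

high : ∀ n → Permutation′ (suc (double n)) → ℕ
high n w = suc (double n) ∸ threshold n w

at-resp : ∀ {m} (v w : Permutation′ m) → v ≈ w → ∀ i → v at i ≡ w at i
at-resp v w v≈w i = cong toℕ (v≈w i)

≈-sym : ∀ {m} (v w : Permutation′ m) → v ≈ w → w ≈ v
≈-sym v w v≈w i = sym (v≈w i)

module _ {m} (v w : Permutation′ m) (v≈w : v ≈ w) where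

  private
    order : ∀ {i j} → v at i < v at j → w at i < w at j
    order {i} {j} = subst₂ _<_ (at-resp v w v≈w i) (at-resp v w v≈w j)

  blocked-resp : ∀ {s} → Blocked v s → Blocked w s
  blocked-resp (i , j , k , i<j , j<k , vi<s , s≤vk , vk<vj) =
    i , j , k , i<j , j<k , subst (_< _) (at-resp v w v≈w i) vi<s ,
    subst (_ ≤_) (at-resp v w v≈w k) s≤vk , order vk<vj

  occurs-resp : Occurs2143 v → Occurs2143 w
  occurs-resp (i , j , k , l , i<j , j<k , k<l , vj<vi , vi<vl , vl<vk) =
    i , j , k , l , i<j , j<k , k<l , order vj<vi , order vi<vl , order vl<vk

  alternating-resp : Alternating v → Alternating w
  alternating-resp alt i j eq = map (order ∘_) (order ∘_) (alt i j eq)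

A-resp : ∀ {m} (v w : Permutation′ m) → v ≈ w → A2143 v → A2143 w
A-resp v w v≈w (alt , av) =
  alternating-resp v w v≈w alt , from (avoids⇔ w) (to (avoids⇔ v) av ∘ occurs-resp w v (≈-sym v w v≈w))

sites-resp : ∀ {m} (v w : Permutation′ m) → v ≈ w → ∀ s → sites v s ≡ sites w s
sites-resp v w v≈w s = sites-cong v w s λ _ _ → mk⇔ (blocked-resp v w v≈w) (blocked-resp w v (≈-sym v w v≈w))

low-resp : ∀ {m} (v w : Permutation′ (suc m)) → v ≈ w → low v ≡ low w
low-resp v w v≈w = trans (cong (sites v) (at-resp v w v≈w 0F)) (sites-resp v w v≈w (w at 0F))

threshold-resp : ∀ n (v w : Permutation′ (suc (double n))) → v ≈ w → threshold n v ≡ threshold n w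
threshold-resp zero    v w v≈w = refl
threshold-resp (suc n) v w v≈w = at-resp v w v≈w 1F

high-resp : ∀ n (v w : Permutation′ (suc (double n))) → v ≈ w → high n v ≡ high n w
high-resp n v w v≈w = cong (suc (double n) ∸_) (threshold-resp n v w v≈w)

tail-resp : ∀ {m} (v w : Permutation′ (suc m)) → v ≈ w → tail v ≈ tail w
tail-resp v w v≈w k = Fₚ.punchIn-injective (w ⟨$⟩ʳ 0F) _ _ (begin
  punchIn (w ⟨$⟩ʳ 0F) (tail v ⟨$⟩ʳ k)  ≡⟨ cong (λ z → punchIn z (tail v ⟨$⟩ʳ k)) (v≈w 0F) ⟨
  punchIn (v ⟨$⟩ʳ 0F) (tail v ⟨$⟩ʳ k)  ≡⟨ suc-↦ v k ⟨
  v ⟨$⟩ʳ suc k                         ≡⟨ v≈w (suc k) ⟩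
  w ⟨$⟩ʳ suc k                         ≡⟨ suc-↦ w k ⟩
  punchIn (w ⟨$⟩ʳ 0F) (tail w ⟨$⟩ʳ k)  ∎)
  where open ≡-Reasoning

≈-from-tail : ∀ {m} (v w : Permutation′ (suc m)) → v at 0F ≡ w at 0F → tail v ≈ tail w → v ≈ w
≈-from-tail v w eq₀ eq zero = Fₚ.toℕ-injective eq₀
≈-from-tail v w eq₀ eq (suc k) = begin
  v ⟨$⟩ʳ suc k                         ≡⟨ suc-↦ v k ⟩
  punchIn (v ⟨$⟩ʳ 0F) (tail v ⟨$⟩ʳ k)  ≡⟨ cong₂ punchIn (Fₚ.toℕ-injective eq₀) (eq k) ⟩
  punchIn (w ⟨$⟩ʳ 0F) (tail w ⟨$⟩ʳ k)  ≡⟨ suc-↦ w k ⟨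
  w ⟨$⟩ʳ suc k                         ∎
  where open ≡-Reasoning

sites-tail : ∀ {m} (w : Permutation′ (suc m)) s → s ≤ w at 0F → sites w s ≡ sites (tail w) s
sites-tail w s s≤ = sites-cong w (tail w) s λ t t≤s → blocked-tail w (≤-trans t≤s s≤)

low-tail² : ∀ {m} (w : Permutation′ (3 + m)) → w at 0F ≤ tail w at 0F → low w ≡ sites (tail² w) (w at 0F)
low-tail² w w₀≤ = trans (sites-tail w (w at 0F) ≤-refl) (sites-tail (tail w) (w at 0F) w₀≤)

threshold-spec : ∀ n (w : Permutation′ (suc (double n))) → A2143 w →
  w at 0F < threshold n w × threshold n w ≤ suc (double n) ×
  (∀ s → w at 0F < s → Free w s ⇔ threshold n w ≤ s)
threshold-spec zero w _ = Fₚ.toℕ<n (w ⟨$⟩ʳ 0F) , ≤-refl , λ s w₀<s →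
  mk⇔ (λ _ → ≤-trans (s≤s z≤n) w₀<s) λ { _ (0F , 0F , _ , () , _) }
threshold-spec (suc n) w a =
  ≤-trans (s≤s (proj₁ (proj₂ (to (A-tail² w) a)))) (≤-reflexive (sym (second-at w a))) ,
  <⇒≤ (Fₚ.toℕ<n (w ⟨$⟩ʳ 1F)) , free-above w a

sites-threshold : ∀ n w → A2143 w → ∀ e → sites w (threshold n w + e) ≡ low w + suc e
sites-threshold n w a = let w₀<h , _ , iff = threshold-spec n w a in sites-above w w₀<h iff

-- The rule for the labels of children

high-second : ∀ n w → A2143 w → ∀ {Y} → high (suc n) w ≡ suc Y → tail w at 0F + Y ≡ suc (double n)
high-second n w a {Y} eq rewrite second-at w a = suc-injective (begin
  suc (u + Y)              ≡⟨ +-suc u Y ⟨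
  u + suc Y                ≡⟨ cong (u +_) eq ⟨
  u + (2 + double n ∸ u)   ≡⟨ m+[n∸m]≡n (<⇒≤ (Fₚ.toℕ<n (tail w ⟨$⟩ʳ 0F))) ⟩
  2 + double n             ∎)
  where
  open ≡-Reasoning
  u = tail w at 0F

high-positive : ∀ n w → high (suc n) w ≢ 0
high-positive n w eq = <⇒≱ (Fₚ.toℕ<n (w ⟨$⟩ʳ 1F)) (m∸n≡0⇒m≤n eq)

-- The second letter is free for `tail² w` and exceeds its first letter, so it lies some `e` above
-- the threshold. Hence the parent has `high` equal to `Y + e`, and `low + suc e` free values up to
-- that letter, among which the first letter has rank `low w`.
parent-labels : ∀ n w → A2143 w → ∀ {Y} → high (suc n) w ≡ suc Y →
  Y ≤ high n (tail² w) × Y + low w ≤ suc (high n (tail² w) + low (tail² w))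
parent-labels n w a {Y} eq with to (A-tail² w) a
... | aρ , w₀≤u , ρ₀<u , free , _ with threshold-spec n (tail² w) aρ
... | _ , _ , iff = ≤-trans (m≤m+n Y e) (≤-reflexive (sym high≡)) , (begin
  Y + low w                               ≡⟨ cong (Y +_) (low-tail² w w₀≤u) ⟩
  Y + sites ρ (w at 0F)                   ≤⟨ +-monoʳ-≤ Y (sites-mono ρ w₀≤u) ⟩
  Y + sites ρ u                           ≡⟨ cong (λ s → Y + sites ρ s) h+e≡u ⟨
  Y + sites ρ (threshold n ρ + e)         ≡⟨ cong (Y +_) (sites-threshold n ρ aρ e) ⟩
  Y + (low ρ + suc e)                     ≡⟨ regroup Y (low ρ) e ⟩
  suc (Y + e + low ρ)                     ≡⟨ cong (λ z → suc (z + low ρ)) high≡ ⟨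
  suc (high n ρ + low ρ)                  ∎)
  where
  open ≤-Reasoning
  ρ = tail² w
  u = tail w at 0F
  e = u ∸ threshold n ρ
  h+e≡u : threshold n ρ + e ≡ u
  h+e≡u = m+[n∸m]≡n (to (iff u ρ₀<u) free)
  high≡ : high n ρ ≡ Y + e
  high≡ = trans (cong (_∸ threshold n ρ) (begin-equality
    suc (double n)           ≡⟨ high-second n w a eq ⟨
    u + Y                    ≡⟨ cong (_+ Y) h+e≡u ⟨
    threshold n ρ + e + Y    ≡⟨ +-assoc (threshold n ρ) e Y ⟩
    threshold n ρ + (e + Y)  ≡⟨ cong (threshold n ρ +_) (+-comm e Y) ⟩
    threshold n ρ + (Y + e)  ∎)) (m+n∸m≡n (threshold n ρ) (Y + e))
  regroup : ∀ Y l e → Y + (l + suc e) ≡ suc (Y + e + l)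
  regroup = solve-∀

-- `high` fixes the second letter, and `low` is the rank of the first among the free values of
-- `tail² w`.
child-unique : ∀ n v w → A2143 v → A2143 w → ∀ {Y} →
  high (suc n) v ≡ suc Y → high (suc n) w ≡ suc Y → low v ≡ low w → tail² v ≈ tail² w → v ≈ w
child-unique n v w av aw {Y} hv hw low≡ tail²≈ with to (A-tail² v) av | to (A-tail² w) aw
... | _ , v₀≤ , _ , _ , free-v | _ , w₀≤ , _ , _ , free-w =
  ≈-from-tail v w first≡ (≈-from-tail (tail v) (tail w) second≡ tail²≈)
  where
  second≡ : tail v at 0F ≡ tail w at 0F
  second≡ = +-cancelʳ-≡ Y _ _ (trans (high-second n v av hv) (sym (high-second n w aw hw)))
  free-v′ : Free (tail² w) (v at 0F)
  free-v′ = free-v ∘ blocked-resp (tail² w) (tail² v) (≈-sym (tail² v) (tail² w) tail²≈)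
  first≡ : v at 0F ≡ w at 0F
  first≡ = sites-injective (tail² w) free-v′ free-w (begin
    sites (tail² w) (v at 0F)  ≡⟨ sites-resp (tail² v) (tail² w) tail²≈ (v at 0F) ⟨
    sites (tail² v) (v at 0F)  ≡⟨ low-tail² v v₀≤ ⟨
    low v                      ≡⟨ low≡ ⟩
    low w                      ≡⟨ low-tail² w w₀≤ ⟩
    sites (tail² w) (w at 0F)  ∎)
    where open ≡-Reasoning

-- Converse of `parent-labels`: `u` lies `high n ρ ∸ Y` above the threshold, and the first letter is
-- the free value of rank `suc k`. The bound on `Y + k` says exactly that this rank occurs up to
-- `u`.
child : ∀ n ρ → A2143 ρ → ∀ {Y k} → Y ≤ high n ρ → Y + k ≤ high n ρ + low ρ →
  ∃[ w ] A2143 w × high (suc n) w ≡ suc Y × low w ≡ suc k × tail² w ≈ ρ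
child n ρ a {Y} {k} Y≤ Y+k≤ = grow (sites-select ρ u k<sites)
  where
  h₀ = threshold n ρ
  e = high n ρ ∸ Y
  u = h₀ + e
  d = suc (double n)

  u+Y : u + Y ≡ d
  u+Y = begin
    h₀ + e + Y           ≡⟨ +-assoc h₀ e Y ⟩
    h₀ + (e + Y)         ≡⟨ cong (h₀ +_) (m∸n+n≡m Y≤) ⟩
    h₀ + high n ρ        ≡⟨ m+[n∸m]≡n (proj₁ (proj₂ (threshold-spec n ρ a))) ⟩
    d                    ∎
    where open ≡-Reasoning

  k<sites : suc k ≤ sites ρ u
  k<sites = +-cancelˡ-≤ Y _ _ (begin
    Y + suc k               ≡⟨ +-suc Y k ⟩
    suc (Y + k)             ≤⟨ s≤s Y+k≤ ⟩
    suc (high n ρ + low ρ)  ≡⟨ cong (λ z → suc (z + low ρ)) (m+[n∸m]≡n Y≤) ⟨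
    suc (Y + e + low ρ)     ≡⟨ regroup Y e (low ρ) ⟩
    Y + (low ρ + suc e)     ≡⟨ cong (Y +_) (sites-threshold n ρ a e) ⟨
    Y + sites ρ u           ∎)
    where
    open ≤-Reasoning
    regroup : ∀ Y e l → suc (Y + e + l) ≡ Y + (l + suc e)
    regroup = solve-∀

  u<d+1 : u < suc d
  u<d+1 = s≤s (≤-trans (m≤m+n u Y) (≤-reflexive u+Y))

  grow : ∃[ t ] t ≤ u × Free ρ t × sites ρ t ≡ suc k →
         ∃[ w ] A2143 w × high (suc n) w ≡ suc Y × low w ≡ suc k × tail² w ≈ ρ
  grow (t , t≤u , free-t , sites≡) = w , aw , high≡ , low≡ , tail²≈
    where
    t<d+2 : t < suc (suc d)
    t<d+2 = m<n⇒m<1+n (≤-<-trans t≤u u<d+1)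
    σ = prepend (fromℕ< u<d+1) ρ
    w = prepend (fromℕ< t<d+2) σ

    w₀≡ : w at 0F ≡ t
    w₀≡ = trans (cong toℕ (prepend-0F (fromℕ< t<d+2) σ)) (Fₚ.toℕ-fromℕ< t<d+2)
    tail≈ : tail w ≈ σ
    tail≈ = tail-prepend (fromℕ< t<d+2) σ
    σ₀≡ : tail w at 0F ≡ u
    σ₀≡ = trans (at-resp (tail w) σ tail≈ 0F)
      (trans (cong toℕ (prepend-0F (fromℕ< u<d+1) ρ)) (Fₚ.toℕ-fromℕ< u<d+1))
    tail²≈ : tail² w ≈ ρ
    tail²≈ i = trans (tail-resp (tail w) σ tail≈ i) (tail-prepend (fromℕ< u<d+1) ρ i)
    ρ≈ : ρ ≈ tail² w
    ρ≈ = ≈-sym (tail² w) ρ tail²≈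

    w₀≤ : w at 0F ≤ tail w at 0F
    w₀≤ = subst₂ _≤_ (sym w₀≡) (sym σ₀≡) t≤u
    spec = threshold-spec n ρ a
    ρ₀<u : ρ at 0F < u
    ρ₀<u = <-≤-trans (proj₁ spec) (m≤m+n h₀ e)
    free-u : Free ρ u
    free-u = from (proj₂ (proj₂ spec) u ρ₀<u) (m≤m+n h₀ e)

    free-resp : ∀ {s s′} → s′ ≡ s → Free ρ s → Free (tail² w) s′
    free-resp refl free = free ∘ blocked-resp (tail² w) ρ tail²≈

    aw : A2143 w
    aw = from (A-tail² w)
      ( A-resp ρ (tail² w) ρ≈ a , w₀≤ , subst₂ _<_ (at-resp ρ (tail² w) ρ≈ 0F) (sym σ₀≡) ρ₀<u
      , free-resp σ₀≡ free-u , free-resp w₀≡ free-t )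

    high≡ : high (suc n) w ≡ suc Y
    high≡ = begin
      3 + double n ∸ w at 1F  ≡⟨ cong (3 + double n ∸_) (trans (second-at w aw) (cong suc σ₀≡)) ⟩
      suc d ∸ u               ≡⟨ cong (λ z → suc z ∸ u) u+Y ⟨
      suc (u + Y) ∸ u         ≡⟨ cong (_∸ u) (+-suc u Y) ⟨
      u + suc Y ∸ u           ≡⟨ m+n∸m≡n u (suc Y) ⟩
      suc Y                   ∎
      where open ≡-Reasoning

    low≡ : low w ≡ suc k
    low≡ = begin
      low w                      ≡⟨ low-tail² w w₀≤ ⟩
      sites (tail² w) (w at 0F)  ≡⟨ sites-resp (tail² w) ρ tail²≈ (w at 0F) ⟩
      sites ρ (w at 0F)          ≡⟨ cong (sites ρ) w₀≡ ⟩
      sites ρ t                  ≡⟨ sites≡ ⟩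
      suc k                      ∎
      where open ≡-Reasoning

-- Each generation raises `high` by at most one, starting from 0.
high-bound : ∀ n w → A2143 w → high n w ≤ n
high-bound zero    w a = z≤n
high-bound (suc n) w a = go (high (suc n) w) refl
  where
  go : ∀ Y → high (suc n) w ≡ Y → Y ≤ suc n
  go zero    _  = z≤n
  go (suc Y) eq = s≤s (≤-trans (proj₁ (parent-labels n w a eq))
    (high-bound n (tail² w) (proj₁ (to (A-tail² w) a))))

-- Counting

card-empty : ∀ {m} {P : Pred (Permutation′ m) 0ℓ} → (∀ w → ¬ P w) → ∣ P ∣≡ 0
card-empty ¬P = record
  { to = λ (); cong = λ { {()} }; bijective = (λ { {()} }) , λ { (w , p) → contradiction p (¬P w) } }

card-singleton : ∀ {m} {P : Pred (Permutation′ m) 0ℓ} → ∃ P → (∀ v w → P v → P w → v ≈ w) → ∣ P ∣≡ 1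
card-singleton (w , p) unique = record
  { to = λ _ → w , p
  ; cong = λ _ _ → refl
  ; bijective = (λ { {0F} {0F} _ → refl }) , λ { (v , q) → 0F , λ _ → unique w v p q }
  }

-- Members are compared as words, so `f` must respect and reflect `≈`; the numbering of `Q` is
-- pulled back through chosen preimages.
card-transport : ∀ {m n k} {P : Pred (Permutation′ m) 0ℓ} {Q : Pred (Permutation′ n) 0ℓ}
  (f : Permutation′ m → Permutation′ n) →
  (∀ w → P w → Q (f w)) →
  (∀ v w → P v → P w → f v ≈ f w → v ≈ w) →
  (∀ v w → v ≈ w → f v ≈ f w) →
  (∀ v → Q v → ∃[ w ] P w × f w ≈ v) →
  ∣ Q ∣≡ k → ∣ P ∣≡ k
card-transport {k = k} {P} {Q} f P⇒Q injective resp surjective β = record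
  { to = λ i → lift i , lift-P i
  ; cong = λ { refl _ → refl }
  ; bijective = (λ {i} {j} eq → Bijection.injective β {i} {j} λ x →
      trans (sym (f-lift i x)) (trans (resp (lift i) (lift j) eq x) (f-lift j x)))
    , λ { (w , p) → let i , hit = Bijection.surjective β (f w , P⇒Q w p) in
          i , λ { refl → injective (lift i) w (lift-P i) p (λ x → trans (f-lift i x) (hit refl x)) } }
  }
  where
  open Bijection β using () renaming (to to elem)
  pre : ∀ i → ∃[ w ] P w × f w ≈ proj₁ (elem i)
  pre i = surjective (proj₁ (elem i)) (proj₂ (elem i))
  lift = λ i → proj₁ (pre i)
  lift-P = λ i → proj₁ (proj₂ (pre i))
  f-lift = λ i → proj₂ (proj₂ (pre i))

-- Disjointness is up to `≈`, as one word can come from different permutation records.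
card-⊎ : ∀ {m a b} {P Q R : Pred (Permutation′ m) 0ℓ} →
  (∀ w → P w → Q w ⊎ R w) → (∀ w → Q w → P w) → (∀ w → R w → P w) →
  (∀ v w → v ≈ w → Q v → R w → ⊥) →
  ∣ Q ∣≡ a → ∣ R ∣≡ b → ∣ P ∣≡ (a + b)
card-⊎ {m} {a} {b} {P} {Q} {R} split Q⇒P R⇒P disjoint α β = record
  { to = elem ∘ splitAt a
  ; cong = λ { refl _ → refl }
  ; bijective = (λ {i} {j} eq → trans (sym (Fₚ.join-splitAt a b i))
      (trans (cong (F.join a b) (elem-injective (splitAt a i) (splitAt a j) eq)) (Fₚ.join-splitAt a b j)))
    , λ { (w , p) → hit w (split w p) }
  }
  where
  module α = Bijection α
  module β = Bijection β
  elem : Fin a ⊎ Fin b → Σ (Permutation′ m) P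
  elem (inj₁ i) = map (λ w → w) (λ {w} → Q⇒P w) (α.to i)
  elem (inj₂ j) = map (λ w → w) (λ {w} → R⇒P w) (β.to j)

  elem-injective : ∀ x y → proj₁ (elem x) ≈ proj₁ (elem y) → x ≡ y
  elem-injective (inj₁ i) (inj₁ j) eq = cong inj₁ (α.injective eq)
  elem-injective (inj₂ i) (inj₂ j) eq = cong inj₂ (β.injective eq)
  elem-injective (inj₁ i) (inj₂ j) eq = ⊥-elim (disjoint _ _ eq (proj₂ (α.to i)) (proj₂ (β.to j)))
  elem-injective (inj₂ i) (inj₁ j) eq = ⊥-elim (disjoint _ _ (λ x → sym (eq x)) (proj₂ (α.to j)) (proj₂ (β.to i)))

  hit : ∀ w → Q w ⊎ R w → ∃[ i ] (∀ {z} → z ≡ i → proj₁ (elem (splitAt a z)) ≈ w)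
  hit w (inj₁ q) with α.surjective (w , q)
  ... | i , eq = i ↑ˡ b , λ { refl → subst (λ x → proj₁ (elem x) ≈ w) (sym (Fₚ.splitAt-↑ˡ a i b)) (eq refl) }
  hit w (inj₂ r) with β.surjective (w , r)
  ... | j , eq = a ↑ʳ j , λ { refl → subst (λ x → proj₁ (elem x) ≈ w) (sym (Fₚ.splitAt-↑ʳ a b j)) (eq refl) }

card-⇔ : ∀ {m k} {P Q : Pred (Permutation′ m) 0ℓ} → (∀ w → P w ⇔ Q w) → ∣ Q ∣≡ k → ∣ P ∣≡ k
card-⇔ iff = card-transport (λ w → w) (λ w → to (iff w)) (λ _ _ _ _ eq → eq) (λ _ _ eq → eq)
  λ w q → w , from (iff w) q , λ _ → refl

-- In a tableau with rows n + 2, n + 1, n, Reach n Y k amounts to the Y largest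
-- entries lying in the last row and the Y + k largest avoiding the first one;
-- Row n Y k requires moreover that the next entry below those Y ends the second
-- row.
Reach Row Cell : ∀ n → ℕ → ℕ → Pred (Permutation′ (suc (double n))) 0ℓ
Reach n Y k w = A2143 w × Y ≤ high n w × Y + k ≤ high n w + low w
Row   n Y k w = A2143 w × high n w ≡ Y × k ≤ low w
Cell  n Y k w = A2143 w × high n w ≡ Y × low w ≡ k

-- The rule for children as a bijection: `Reach n Y k` describes the parents having a child with the
-- given labels, and each has just one.
card-cell : ∀ n Y k {a} → ∣ Reach n Y k ∣≡ a → ∣ Cell (suc n) (suc Y) (suc k) ∣≡ a
card-cell n Y k = card-transport tail²
  (λ { w (a , high≡ , low≡) → let Y≤ , bound = parent-labels n w a high≡ in
    proj₁ (to (A-tail² w) a) , Y≤ , ≤-pred (begin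
      suc (Y + k)  ≡⟨ +-suc Y k ⟨
      Y + suc k    ≡⟨ cong (Y +_) low≡ ⟨
      Y + low w    ≤⟨ bound ⟩
      suc (high n (tail² w) + low (tail² w)) ∎) })
  (λ { v w (av , hv , lv) (aw , hw , lw) → child-unique n v w av aw hv hw (trans lv (sym lw)) })
  (λ v w v≈w → tail-resp (tail v) (tail w) (tail-resp v w v≈w))
  (λ { ρ (a , Y≤ , Y+k≤) → let w , aw , high≡ , low≡ , eq = child n ρ a Y≤ Y+k≤ in
    w , (aw , high≡ , low≡) , eq })
  where open ≤-Reasoning

card-row-step : ∀ n Y k {a b} →
  ∣ Row n Y (suc k) ∣≡ a → ∣ Cell n Y k ∣≡ b → ∣ Row n Y k ∣≡ (a + b)
card-row-step n Y k = card-⊎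
  (λ { w (a , high≡ , k≤) → case m≤n⇒m<n∨m≡n k≤ of λ
    { (inj₁ k<) → inj₁ (a , high≡ , k<) ; (inj₂ eq) → inj₂ (a , high≡ , sym eq) } })
  (λ { w (a , high≡ , k<) → a , high≡ , <⇒≤ k< })
  (λ { w (a , high≡ , eq) → a , high≡ , ≤-reflexive (sym eq) })
  (λ { v w v≈w (_ , _ , k<) (_ , _ , eq) → <-irrefl (trans (sym eq) (sym (low-resp v w v≈w))) k< })

-- Either `high` is `Y`, or one unit moves from `k` to `Y`. This mirrors deleting from the second or
-- from the third row in `shiftedTail`.
card-reach-step : ∀ n Y k {a b} →
  ∣ Row n Y (suc k) ∣≡ a → ∣ Reach n (suc Y) k ∣≡ b → ∣ Reach n Y (suc k) ∣≡ (a + b)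
card-reach-step n Y k = card-⊎
  (λ { w (a , Y≤ , Y+k≤) → case m≤n⇒m<n∨m≡n Y≤ of λ
    { (inj₁ Y<) → inj₂ (a , Y< , subst (_≤ high n w + low w) (+-suc Y k) Y+k≤)
    ; (inj₂ eq) → inj₁ (a , sym eq , +-cancelˡ-≤ Y _ _
        (subst (λ z → Y + suc k ≤ z + low w) (sym eq) Y+k≤)) } })
  (λ { w (a , refl , k<) → a , ≤-refl , +-monoʳ-≤ (high n w) k< })
  (λ { w (a , Y< , Y+k≤) → a , <⇒≤ Y< , subst (_≤ high n w + low w) (sym (+-suc Y k)) Y+k≤ })
  (λ { v w v≈w (_ , eq , _) (_ , Y< , _) → <-irrefl (trans (sym eq) (high-resp n v w v≈w)) Y< })

card-reach-zero : ∀ n Y {a} → ∣ Reach n Y 1 ∣≡ a → ∣ Reach n Y 0 ∣≡ a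
card-reach-zero n Y = card-⇔ λ w → mk⇔
  (λ { (a , Y≤ , _) → a , Y≤ , +-mono-≤ Y≤ (0<sites w (w at 0F)) })
  (λ { (a , Y≤ , Y+1≤) → a , Y≤ , ≤-trans (+-monoʳ-≤ Y z≤n) Y+1≤ })

low-bound : ∀ {m} (w : Permutation′ (suc m)) → low w ≤ suc m
low-bound w = ≤-trans (sites-bound w (w at 0F)) (Fₚ.toℕ<n (w ⟨$⟩ʳ 0F))

-- The recursion for `Row` leads from `k` to `suc k`, so it is run backwards from a bound past which
-- nothing is left.
downward : (P : ℕ → Set) (b : ℕ) → (∀ k → b ≤ k → P k) → (∀ k → P (suc k) → P k) → ∀ k → P k
downward P zero    base step k = base k z≤n
downward P (suc b) base step k = downward P b base′ step k
  where
  base′ : ∀ k → b ≤ k → P k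
  base′ k b≤k = step k (base (suc k) (s≤s b≤k))

A-single : (w : Permutation′ 1) → A2143 w
A-single w =
  (λ { 0F 0F () }) , from (avoids⇔ w) λ { (0F , 0F , _ , _ , () , _) }

-- The rows have lengths `n + 2, n + 1, r` in `card-reach` and, after a deletion from the second
-- row, `n + 2, n, r` here. A deletion from the first row then gives the shape of `card-reach` for
-- `n - 1` and `Y - 1`, matching the step to the parents in `card-cell`.
card-row : ∀ n Y r → Y + r ≡ n → ∀ k → ∣ Row n Y (suc k) ∣≡ shiftedTail k 2 Y r
card-reach⁺ : ∀ n Y r → Y + r ≡ n → ∀ k → ∣ Reach n Y (suc k) ∣≡ shiftedTail (suc k) 1 (suc Y) r
card-reach : ∀ n Y r → Y + r ≡ n → ∀ k → ∣ Reach n Y k ∣≡ shiftedTail k 1 (suc Y) r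

card-row zero zero zero refl zero = card-singleton
  (Perm.id , A-single Perm.id , refl , 0<sites Perm.id 0) λ { v w _ _ 0F → single (v ⟨$⟩ʳ 0F) (w ⟨$⟩ʳ 0F) }
  where
  single : (x y : Fin 1) → x ≡ y
  single 0F 0F = refl
card-row zero zero zero refl (suc k) =
  card-empty λ { w (_ , _ , 2+k≤) → case ≤-trans 2+k≤ (low-bound w) of λ { (s≤s ()) } }
-- The last two rows would have equal positive length, while `high` is positive from three letters
-- on.
card-row (suc n) zero (suc r) refl k =
  subst (∣ Row (suc n) 0 (suc k) ∣≡_) (sym (vanish k))
    (card-empty λ { w (_ , high≡ , _) → high-positive n w high≡ })
  where
  vanish : ∀ k → shiftedTail k 2 0 (suc r) ≡ 0
  vanish zero    = refl
  vanish (suc k) = refl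
card-row (suc n) (suc Y) r eq =
  downward (λ k → ∣ Row (suc n) (suc Y) (suc k) ∣≡ shiftedTail k 2 (suc Y) r)
    -- Past the first summand `shiftedTail` vanishes; the second bounds `low`.
    (suc (suc Y + 2 * r) + suc (double (suc n)))
    (λ k b≤k → subst (∣ Row (suc n) (suc Y) (suc k) ∣≡_)
      (sym (shiftedTail-vanishes k 2 (suc Y) r (m+n≤o⇒m≤o _ b≤k)))
      (card-empty λ { w (_ , _ , k<) →
        <⇒≱ (≤-<-trans (m+n≤o⇒n≤o (suc (suc Y + 2 * r)) b≤k) k<) (low-bound w) }))
    (λ k row → subst (∣ Row (suc n) (suc Y) (suc k) ∣≡_) (sym (shiftedTail-split k 1 (suc Y) r))
      (card-row-step (suc n) (suc Y) (suc k) row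
        (card-cell n Y k (card-reach n Y r (suc-injective eq) k))))

-- Here `Y = n` is the largest possible `high`, just as the last row is empty.
card-reach⁺ n Y zero eq k = subst (∣ Reach n Y (suc k) ∣≡_) (+-identityʳ _)
  (card-reach-step n Y k (card-row n Y 0 eq k)
    (card-empty λ { w (a , Y< , _) →
      <⇒≱ Y< (≤-trans (high-bound n w a) (≤-reflexive (trans (sym eq) (+-identityʳ Y)))) }))
card-reach⁺ n Y (suc r) eq k =
  card-reach-step n Y k (card-row n Y (suc r) eq k) (card-reach n (suc Y) r (trans (sym (+-suc Y r)) eq) k)

card-reach n Y r eq zero = card-reach-zero n Y
  -- The dropped summand is `shifted 0 (suc Y) r`, which is 0 because the first two rows would be
  -- equal.
  (subst (∣ Reach n Y 1 ∣≡_) (sym (trans (shiftedTail-split 0 0 (suc Y) r) (+-identityʳ _)))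
    (card-reach⁺ n Y r eq 0))
card-reach n Y r eq (suc k) = card-reach⁺ n Y r eq k

-- `Reach n 0 0` imposes nothing beyond membership.
card-A : ∀ n → ∣ A (suc (double n)) p2143 ∣≡ shifted 1 1 n
card-A n = card-⇔ (λ w → mk⇔ (λ a → a , z≤n , z≤n) proj₁) (card-reach n 0 n refl 0)

-- The closed formula

double-+ : ∀ n → suc (double n) ≡ 2 * n + 1
double-+ zero    = refl
double-+ (suc n) = trans (cong (2 +_) (double-+ n)) (eq n)
  where
  eq : ∀ n → 2 + (2 * n + 1) ≡ 2 * suc n + 1
  eq = solve-∀

open ℤ using (+_)

/-exact : ∀ a x d .{{_ : NonZero d}} → a * d ≡ x → + a / 1 ≡ + x / d
/-exact a x (suc d) eq = fromℚᵘ-cong {mkℚᵘ (+ a) 0} {mkℚᵘ (+ x) d} (*≡* (begin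
  + a ℤ.* + suc d  ≡⟨ ℤₚ.pos-* a (suc d) ⟨
  + (a * suc d)    ≡⟨ cong +_ eq ⟩
  + x              ≡⟨ ℤₚ.*-identityʳ (+ x) ⟨
  + x ℤ.* + 1      ∎))
  where open ≡-Reasoning

proposition5p1 : ∀ (n : ℕ) →
    ∃[ a ] (∣ A (2 * n + 1) p2143 ∣≡ a) ×
    (+ a / 1 ≡
    _/_ (+ (2 * (3 * n + 3) !))
    (n ! * (n + 1) ! * (n + 2) ! * ((2 * n + 1) * (2 * n + 2) * (2 * n + 3)))
    ⦃ denominator-nonZero n ⦄)
proposition5p1 n =
  shifted 1 1 n ,
  subst (λ m → ∣ A m p2143 ∣≡ shifted 1 1 n) (double-+ n) (card-A n) ,
  /-exact (shifted 1 1 n) _ _ ⦃ denominator-nonZero n ⦄ (shifted-staircase n)
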